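{- $r'_2(3)=3$ and $r'_2(4)=6$.
   Context: All graphs are finite and simple. A threshold graph of order $s$ is an $s$-vertex graph that can be constructed from the one-vertex graph by repeatedly adding a new vertex that is either adjacent to all the previous vertices or nonadjacent to all the previous vertices. For a positive integer $s$, $r'_2(s)$ is the minimum integer $n$ such that every $n$-vertex graph contains a threshold graph of order $s$ as an induced subgraph. -}

module Defs where

open import Data.Bool using (Bool; T)
open import Data.Bool.Properties using (T?)
open import Data.Empty using (⊥)
open import Data.Fin using (Fin; zero; suc)
open import Data.Nat using (ℕ; zero; suc; _≤_)
open import Data.Product using (Σ; _×_)
open import Function.Bundles using (_↣_; _↔_; _⇔_; Injection; Inverse)
open import Level using (0ℓ)
open import Relation.Binary.Core using (Rel)
open import Relation.Binary.Definitions using (Symmetric; Irreflexive; Decidable)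
open import Relation.Binary.PropositionalEquality using (_≡_; refl)
open import Relation.Nullary using (no)

-- Finite simple graphs on the vertex set Fin n. The null graph (n = 0) is
-- included. Adjacency is decidable, as is always the case classically.
record Graph (n : ℕ) : Set₁ where
  field
    Adj    : Rel (Fin n) 0ℓ
    sym    : Symmetric Adj
    irrefl : Irreflexive _≡_ Adj
    adj?   : Decidable Adj

open Graph

_≅_ : ∀ {n} → Graph n → Graph n → Set
_≅_ {n} G H = Σ (Fin n ↔ Fin n) λ f →
  ∀ i j → Adj G i j ⇔ Adj H (Inverse.to f i) (Inverse.to f j)

-- G contains H as an induced subgraph: H embeds in G, preserving both
-- adjacency and nonadjacency. Injectivity has to be asked for separately,
-- since nonadjacent vertices could otherwise be identified.
_InducedIn_ : ∀ {s n} → Graph s → Graph n → Set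
_InducedIn_ {s} {n} H G = Σ (Fin s ↣ Fin n) λ f →
  ∀ i j → Adj H i j ⇔ Adj G (Injection.to f i) (Injection.to f j)

K₁ : Graph 1
K₁ .Adj _ _    = ⊥
K₁ .sym ()
K₁ .irrefl _ ()
K₁ .adj? _ _   = no λ ()

-- The new vertex is zero, and the previous vertex i becomes suc i. The new
-- vertex is adjacent to all previous vertices if b is true, and to none of
-- them if b is false.
addVertex : ∀ {s} → Bool → Graph s → Graph (suc s)
addVertex {s} b G = record
  { Adj    = A
  ; sym    = λ {i} {j} → A-sym i j
  ; irrefl = λ { {i} refl → A-irrefl i }
  ; adj?   = A?
  }
  where
  A : Rel (Fin (suc s)) 0ℓ
  A zero    zero    = ⊥
  A zero    (suc _) = T b
  A (suc _) zero    = T b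
  A (suc i) (suc j) = Adj G i j

  A-sym : ∀ i j → A i j → A j i
  A-sym zero    (suc _) p = p
  A-sym (suc _) zero    p = p
  A-sym (suc _) (suc _) p = sym G p

  A-irrefl : ∀ i → A i i → ⊥
  A-irrefl (suc _) p = irrefl G refl p

  A? : Decidable A
  A? zero    zero    = no λ ()
  A? zero    (suc _) = T? b
  A? (suc _) zero    = T? b
  A? (suc i) (suc j) = adj? G i j

data Constructible : ∀ {s} → Graph s → Set₁ where
  start : Constructible K₁
  add   : ∀ {s} {G : Graph s} (b : Bool) →
          Constructible G → Constructible (addVertex b G)

-- addVertex fixes how the vertices are labelled, so the notion is closed
-- under isomorphism here.
Threshold : ∀ {s} → Graph s → Set₁
Threshold {s} G = Σ (Graph s) λ H → Constructible H × H ≅ G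

EveryGraphHasThreshold : ℕ → ℕ → Set₁
EveryGraphHasThreshold s n =
  (G : Graph n) → Σ (Graph s) λ H → Threshold H × H InducedIn G

-- "n is the value of r′₂ at s". Given as a relation because r′₂ is a total
-- function only by a Ramsey-type theorem; the minimality clause makes n unique.
r′₂[_]≡_ : ℕ → ℕ → Set₁
r′₂[ s ]≡ n =
  EveryGraphHasThreshold s n × (∀ m → EveryGraphHasThreshold s m → n ≤ m)

{-# OPTIONS --safe #-}

-- By R(3,3) = 6, a graph on six vertices has three vertices that are pairwise
-- joined by the same colour b (adjacent or nonadjacent). Together with any
-- fourth vertex v they induce a threshold graph: if v is b-joined to one of
-- the three, say x, then x is b-joined to all the others and comes last in the
-- construction, and every graph on three vertices is threshold; otherwise v
-- itself is joined to all three by the opposite colour and comes last.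
-- In the 5-cycle every vertex has two neighbours and two non-neighbours, so no
-- vertex can come last in the construction of a subgraph of order 4.
module Submission where

open import Defs
open import Data.Bool using (Bool; true; false; not; T; _≟_)
open import Data.Bool.Properties using (¬-not; not-injective)
open import Data.Empty using (⊥; ⊥-elim)
open import Data.Fin as Fin using (Fin; zero; suc; toℕ; inject≤)
open import Data.Fin.Properties using (any?; all?; inject≤-injective; injective⇒≤)
open import Data.List using (List; []; _∷_; length; lookup; filter)
open import Data.List.Membership.DecPropositional using () renaming (_∈?_ to member?)
open import Data.List.Membership.Propositional using (_∈_; _∉_)
open import Data.List.Membership.Propositional.Properties using (∈-lookup)
open import Data.List.Relation.Binary.Permutation.Propositional
  using (_↭_; prep; swap; ↭-refl; ↭-sym; ↭-trans)
open import Data.List.Relation.Binary.Permutation.Propositional.Properties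
  using (All-resp-↭; ↭-length)
open import Data.List.Relation.Unary.All as All using (All; []; _∷_)
import Data.List.Relation.Unary.All.Properties as All
open import Data.List.Relation.Unary.AllPairs using (AllPairs; []; _∷_; allPairs?)
open import Data.List.Relation.Unary.Any using (index)
open import Data.List.Relation.Unary.Any.Properties using (lookup-index)
open import Data.List.Relation.Unary.Unique.Propositional using (Unique)
import Data.List.Relation.Unary.Unique.Propositional.Properties as Unique
open import Data.Nat using (ℕ; suc; _+_; _≤_; _<_; z≤n; s≤s; s≤s⁻¹; _≤?_)
open import Data.Nat.DivMod using (_mod_)
open import Data.Nat.Properties
  using (≤-refl; ≤-trans; ≮⇒≥; ≰⇒>; <⇒≱; +-suc; +-monoˡ-≤; +-cancelˡ-≤)
open import Data.Product using (Σ; ∃-syntax; _×_; _,_; proj₁)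
import Data.Sum as Sum
open import Data.Sum using (_⊎_)
open import Function.Base using (_∘_; id)
open import Function.Bundles using (_⇔_; mk⇔; mk↣; module Injection)
open import Function.Construct.Composition using (_⇔-∘_; _↣-∘_)
open import Function.Construct.Identity using (⇔-id; ↔-id)
open import Function.Construct.Symmetry using (⇔-sym)
open import Function.Definitions using (Injective)
open import Function.Properties.Inverse using (↔⇒↣)
open import Relation.Binary.PropositionalEquality
  using (_≡_; _≢_; refl; sym; trans; cong; subst; ≢-sym)
open import Relation.Nullary using (Dec; yes; no; does; ¬_; contradiction)
open import Relation.Nullary.Decidable
  using (does-⇔; from-yes; decidable-stable; ¬?; _→-dec_; _⊎-dec_)

open Graph hiding (sym)

-- Induced subgraphs and restriction to fewer vertices.

ContainsThreshold : ∀ {n} → ℕ → Graph n → Set₁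
ContainsThreshold s G = Σ (Graph s) λ H → Threshold H × H InducedIn G

InducedIn-trans : ∀ {k m n} {F : Graph k} {G : Graph m} {H : Graph n} →
                  F InducedIn G → G InducedIn H → F InducedIn H
InducedIn-trans (f , f-adj) (g , g-adj) =
  g ↣-∘ f , λ i j → g-adj (Injection.to f i) (Injection.to f j) ⇔-∘ f-adj i j

≅⇒InducedIn : ∀ {n} {G H : Graph n} → G ≅ H → G InducedIn H
≅⇒InducedIn (f , f-adj) = ↔⇒↣ f , f-adj

≅-refl : ∀ {n} {G : Graph n} → G ≅ G
≅-refl = ↔-id _ , λ _ _ → ⇔-id _

restrict : ∀ {m n} → m ≤ n → Graph n → Graph m
restrict m≤n G = record
  { Adj    = λ i j → Adj G (inject≤ i m≤n) (inject≤ j m≤n)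
  ; sym    = Graph.sym G
  ; irrefl = λ { refl → irrefl G refl }
  ; adj?   = λ i j → adj? G (inject≤ i m≤n) (inject≤ j m≤n)
  }

restrict-InducedIn : ∀ {m n} (m≤n : m ≤ n) (G : Graph n) → restrict m≤n G InducedIn G
restrict-InducedIn m≤n G =
  mk↣ (λ {i} {j} → inject≤-injective m≤n m≤n i j) , λ _ _ → ⇔-id _

-- Apply the property for `m` to the restriction of `G` to its first `m` vertices. This reduces the
-- lower bound 6 to a single counterexample on five vertices.
EveryGraphHasThreshold-mono : ∀ {s m n} → m ≤ n →
                              EveryGraphHasThreshold s m → EveryGraphHasThreshold s n
EveryGraphHasThreshold-mono m≤n every G
  with H , H-threshold , H-induced ← every (restrict m≤n G) =
  H , H-threshold ,
  InducedIn-trans {F = H} {restrict m≤n G} {G} H-induced (restrict-InducedIn m≤n G)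

InducedIn⇒≤ : ∀ {s n} {H : Graph s} {G : Graph n} → H InducedIn G → s ≤ n
InducedIn⇒≤ (f , _) = injective⇒≤ (Injection.injective f)

-- Auxiliary facts on decisions, lists and Booleans.

T-does : ∀ {A : Set} (a? : Dec A) → T (does a?) ⇔ A
T-does (yes a) = mk⇔ (λ _ → a) _
T-does (no ¬a) = mk⇔ ⊥-elim ¬a

lookup-injective : ∀ {A : Set} {xs : List A} → Unique xs →
                   ∀ i j → lookup xs i ≡ lookup xs j → i ≡ j
lookup-injective (_ ∷ _)    zero    zero    _  = refl
lookup-injective (x≢xs ∷ _) zero    (suc j) eq = contradiction eq (All.lookup x≢xs (∈-lookup j))
lookup-injective (x≢xs ∷ _) (suc i) zero    eq = contradiction (sym eq) (All.lookup x≢xs (∈-lookup i))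
lookup-injective (_ ∷ xs!)  (suc i) (suc j) eq = cong suc (lookup-injective xs! i j eq)

≢⇒≡ : ∀ {a b c : Bool} → a ≢ b → a ≢ c → b ≡ c
≢⇒≡ a≢b a≢c = not-injective (trans (sym (¬-not a≢b)) (¬-not a≢c))

-- Threshold subgraphs as ordered lists of vertices.

colour : ∀ {n} → Graph n → Fin n → Fin n → Bool
colour G u v = does (adj? G u v)

module _ {n} (G : Graph n) where

  -- Distinctness is built in because `colour G u u` is `false`, so a vertex would otherwise be
  -- `false`-linked to itself. It also makes every construction order repetition-free.
  Linked : Bool → Fin n → Fin n → Set
  Linked b u v = u ≢ v × colour G u v ≡ b

  linked-sym : ∀ {b u v} → Linked b u v → Linked b v u
  linked-sym {u = u} {v} (u≢v , refl) =
    ≢-sym u≢v , does-⇔ (mk⇔ (Graph.sym G) (Graph.sym G)) (adj? G v u) (adj? G u v)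

  linked-adj : ∀ {b u v} → Linked b u v → T b ⇔ Adj G u v
  linked-adj {u = u} {v} (_ , refl) = T-does (adj? G u v)

  -- The head of the list is the vertex added last.
  data ConstructionOrder : List (Fin n) → Set where
    [_] : ∀ v → ConstructionOrder (v ∷ [])
    _∷_ : ∀ {b v vs} → All (Linked b v) vs → ConstructionOrder vs → ConstructionOrder (v ∷ vs)

  order-unique : ∀ {vs} → ConstructionOrder vs → Unique vs
  order-unique [ v ]        = [] ∷ []
  order-unique (links ∷ vs) = All.map proj₁ links ∷ order-unique vs

  order-graph : ∀ {vs} → ConstructionOrder vs →
                Σ (Graph (length vs)) λ H → Constructible H ×
                  ∀ i j → Adj H i j ⇔ Adj G (lookup vs i) (lookup vs j)
  order-graph [ v ] = K₁ , start , λ { zero zero → mk⇔ ⊥-elim (irrefl G refl) }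
  order-graph {v ∷ vs} (_∷_ {b} links order)
    with H , H-constructible , H-adj ← order-graph order =
    addVertex b H , add b H-constructible , adj
    where
    link : ∀ i → Linked b v (lookup vs i)
    link i = All.lookup links (∈-lookup i)

    adj : ∀ i j → Adj (addVertex b H) i j ⇔ Adj G (lookup (v ∷ vs) i) (lookup (v ∷ vs) j)
    adj zero    zero    = mk⇔ ⊥-elim (irrefl G refl)
    adj zero    (suc j) = linked-adj (link j)
    adj (suc i) zero    = linked-adj (linked-sym (link i))
    adj (suc i) (suc j) = H-adj i j

  -- Permutations are allowed so that any vertex of `vs` may be chosen as the last one. They
  -- preserve the length, and hence the order of the threshold graph obtained.
  Orderable : List (Fin n) → Set
  Orderable vs = ∃[ ws ] ws ↭ vs × ConstructionOrder ws

  orderable⇒containsThreshold : ∀ {vs} → Orderable vs → ContainsThreshold (length vs) G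
  orderable⇒containsThreshold (ws , ws↭vs , order)
    with H , H-constructible , H-adj ← order-graph order =
    subst (λ s → ContainsThreshold s G) (↭-length ws↭vs)
      (H , (H , H-constructible , ≅-refl {G = H}) ,
       mk↣ (λ {i} {j} → lookup-injective (order-unique order) i j) , H-adj)

  orderable-∷ : ∀ {b v vs} → All (Linked b v) vs → Orderable vs → Orderable (v ∷ vs)
  orderable-∷ links (ws , ws↭vs , order) =
    _ , prep _ ws↭vs , All-resp-↭ (↭-sym ws↭vs) links ∷ order

  orderable-resp-↭ : ∀ {vs ws} → vs ↭ ws → Orderable vs → Orderable ws
  orderable-resp-↭ vs↭ws (us , us↭vs , order) = us , ↭-trans us↭vs vs↭ws , order

  orderable₂ : ∀ {x y} → x ≢ y → Orderable (x ∷ y ∷ [])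
  orderable₂ x≢y = _ , ↭-refl , ((x≢y , refl) ∷ []) ∷ [ _ ]

  -- Two of the three pairs have the same colour, and they share a vertex. That vertex comes last,
  -- and the permutation returns it to its place in the list.
  orderable₃ : ∀ {x y z} → Unique (x ∷ y ∷ z ∷ []) → Orderable (x ∷ y ∷ z ∷ [])
  orderable₃ {x} {y} {z} ((x≢y ∷ x≢z ∷ []) ∷ (y≢z ∷ []) ∷ _)
    with colour G x y ≟ colour G x z | colour G x y ≟ colour G y z
  ... | yes xy≡xz | _ = orderable-∷ ((x≢y , xy≡xz) ∷ (x≢z , refl) ∷ []) (orderable₂ y≢z)
  ... | no _ | yes xy≡yz =
    orderable-resp-↭ (swap y x ↭-refl)
      (orderable-∷ (linked-sym (x≢y , xy≡yz) ∷ (y≢z , refl) ∷ []) (orderable₂ x≢z))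
  -- The pairs `x z` and `y z` both differ from `x y`, so they agree and `z` comes last.
  ... | no xy≢xz | no xy≢yz =
    orderable-resp-↭ (↭-trans (swap z x ↭-refl) (prep x (swap z y ↭-refl)))
      (orderable-∷ (linked-sym (x≢z , ≢⇒≡ xy≢xz xy≢yz) ∷ linked-sym (y≢z , refl) ∷ [])
        (orderable₂ x≢y))

  Monochromatic : Bool → List (Fin n) → Set
  Monochromatic b = AllPairs (Linked b)

  -- Whichever vertex is placed last, the other three need only be distinct for `orderable₃` to
  -- order them.
  orderable₄ : ∀ {b v x y z} → All (v ≢_) (x ∷ y ∷ z ∷ []) →
               Monochromatic b (x ∷ y ∷ z ∷ []) → Orderable (v ∷ x ∷ y ∷ z ∷ [])
  orderable₄ {b} {v} {x} {y} {z} (v≢x ∷ v≢y ∷ v≢z ∷ []) ((xy ∷ xz ∷ []) ∷ (yz ∷ []) ∷ _)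
    with colour G v x ≟ b | colour G v y ≟ b | colour G v z ≟ b
  ... | yes vx | _ | _ =
    orderable-resp-↭ (swap x v ↭-refl)
      (orderable-∷ (linked-sym (v≢x , vx) ∷ xy ∷ xz ∷ [])
        (orderable₃ ((v≢y ∷ v≢z ∷ []) ∷ (proj₁ yz ∷ []) ∷ [] ∷ [])))
  ... | no _ | yes vy | _ =
    orderable-resp-↭ (↭-trans (swap y v ↭-refl) (prep v (swap y x ↭-refl)))
      (orderable-∷ (linked-sym (v≢y , vy) ∷ linked-sym xy ∷ yz ∷ [])
        (orderable₃ ((v≢x ∷ v≢z ∷ []) ∷ (proj₁ xz ∷ []) ∷ [] ∷ [])))
  ... | no _ | no _ | yes vz =
    orderable-resp-↭
      (↭-trans (swap z v ↭-refl) (prep v (↭-trans (swap z x ↭-refl) (prep x (swap z y ↭-refl)))))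
      (orderable-∷ (linked-sym (v≢z , vz) ∷ linked-sym xz ∷ linked-sym yz ∷ [])
        (orderable₃ ((v≢x ∷ v≢y ∷ []) ∷ (proj₁ xy ∷ []) ∷ [] ∷ [])))
  ... | no vx | no vy | no vz =
    orderable-∷ ((v≢x , ¬-not vx) ∷ (v≢y , ¬-not vy) ∷ (v≢z , ¬-not vz) ∷ [])
      (orderable₃ ((proj₁ xy ∷ proj₁ xz ∷ []) ∷ (proj₁ yz ∷ []) ∷ [] ∷ []))

-- Counting in lists.

length-filter-split : ∀ {A : Set} (f : A → Bool) xs →
  length (filter (λ x → f x ≟ true) xs) + length (filter (λ x → f x ≟ false) xs) ≡ length xs
length-filter-split f [] = refl
length-filter-split f (x ∷ xs) with f x
... | true  = cong suc (length-filter-split f xs)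
... | false = trans (+-suc _ _) (cong suc (length-filter-split f xs))

-- If at most `k` entries are `true`, then `k + suc k` is at most `k` plus the number of `false`
-- entries; cancel `k`.
majority : ∀ {A : Set} (f : A → Bool) k xs → suc (k + k) ≤ length xs →
           ∃[ b ] k < length (filter (λ x → f x ≟ b) xs)
majority f k xs large with suc k ≤? length (filter (λ x → f x ≟ true) xs)
... | yes k<trues = true , k<trues
... | no  k≮trues = false , +-cancelˡ-≤ k _ _
  (≤-trans (subst (_ ≤_) (sym (length-filter-split f xs)) (subst (_≤ length xs) (sym (+-suc k k)) large))
           (+-monoˡ-≤ _ (s≤s⁻¹ (≰⇒> k≮trues))))

-- If every vertex occurred in `xs`, its position there would inject `Fin n` into `Fin (length xs)`.
∃-∉ : ∀ {n} (xs : List (Fin n)) → length xs < n → ∃[ v ] v ∉ xs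
∃-∉ xs short with any? (λ v → ¬? (member? Fin._≟_ v xs))
... | yes v∉xs = v∉xs
... | no  none = contradiction (injective⇒≤ position-injective) (<⇒≱ short)
  where
  v∈xs : ∀ v → v ∈ xs
  v∈xs v = decidable-stable (member? Fin._≟_ v xs) (λ v∉xs → none (v , v∉xs))

  position-injective : Injective _≡_ _≡_ (index ∘ v∈xs)
  position-injective {u} {v} eq =
    trans (lookup-index (v∈xs u)) (trans (cong (lookup xs) eq) (sym (lookup-index (v∈xs v))))

-- The bound R(3,3) ≤ 6.

module _ {n} (G : Graph n) where

  monochromatic-triple : ∀ {v vs} → Unique (v ∷ vs) → 5 ≤ length vs →
    ∃[ b ] ∃[ x ] ∃[ y ] ∃[ z ] Monochromatic G b (x ∷ y ∷ z ∷ [])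
  monochromatic-triple {v} {vs} (v≢vs ∷ vs-unique) 5≤∣vs∣
    -- Since 5 = 2 + 2 + 1, some three of the other vertices have the same colour `b` towards `v`. A
    -- pair of them coloured `b` completes a triple with `v`.
    with b , 2<∣ws∣ ← majority (colour G v) 2 vs 5≤∣vs∣ =
    within (filter isLinked? vs) 2<∣ws∣ (Unique.filter⁺ isLinked? vs-unique)
      (All.zip (All.filter⁺ isLinked? v≢vs , All.all-filter isLinked? vs))
    where
    isLinked? = λ u → colour G v u ≟ b

    within : ∀ ws → 2 < length ws → Unique ws → All (Linked G b v) ws →
      ∃[ c ] ∃[ x ] ∃[ y ] ∃[ z ] Monochromatic G c (x ∷ y ∷ z ∷ [])
    within (x ∷ y ∷ z ∷ _) _ ((x≢y ∷ x≢z ∷ _) ∷ (y≢z ∷ _) ∷ _) (vx ∷ vy ∷ vz ∷ _)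
      with colour G x y ≟ b | colour G x z ≟ b | colour G y z ≟ b
    ... | yes xy | _ | _ = b , v , x , y , (vx ∷ vy ∷ []) ∷ ((x≢y , xy) ∷ []) ∷ [] ∷ []
    ... | _ | yes xz | _ = b , v , x , z , (vx ∷ vz ∷ []) ∷ ((x≢z , xz) ∷ []) ∷ [] ∷ []
    ... | _ | _ | yes yz = b , v , y , z , (vy ∷ vz ∷ []) ∷ ((y≢z , yz) ∷ []) ∷ [] ∷ []
    -- No pair has colour `b`, so the three vertices form a triple of the opposite colour.
    ... | no xy | no xz | no yz = not b , x , y , z ,
      ((x≢y , ¬-not xy) ∷ (x≢z , ¬-not xz) ∷ []) ∷ ((y≢z , ¬-not yz) ∷ []) ∷ [] ∷ []
    within (_ ∷ [])     (s≤s ())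
    within (_ ∷ _ ∷ []) (s≤s (s≤s ()))

-- Upper bounds.

everyGraphHasThreshold-3-3 : EveryGraphHasThreshold 3 3
everyGraphHasThreshold-3-3 G =
  orderable⇒containsThreshold G (orderable₃ G (Unique.allFin⁺ 3))

everyGraphHasThreshold-4-6 : EveryGraphHasThreshold 4 6
everyGraphHasThreshold-4-6 G
  -- Removing the head of the six vertices leaves exactly the five that are required.
  with b , x , y , z , xyz ← monochromatic-triple G (Unique.allFin⁺ 6) ≤-refl
  with v , v∉xyz ← ∃-∉ (x ∷ y ∷ z ∷ []) (s≤s (s≤s (s≤s (s≤s z≤n)))) =
  orderable⇒containsThreshold G (orderable₄ G (All.¬Any⇒All¬ _ v∉xyz) xyz)

-- The 5-cycle and the lower bounds.

C₅ : Graph 5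
C₅ = record
  { Adj    = λ i j → j ≡ next i ⊎ i ≡ next j
  ; sym    = Sum.swap
  ; irrefl = λ { {i} refl → irreflexive i }
  ; adj?   = λ i j → (j Fin.≟ next i) ⊎-dec (i Fin.≟ next j)
  }
  where
  next : Fin 5 → Fin 5
  next i = suc (toℕ i) mod 5

  irreflexive : ∀ i → ¬ (i ≡ next i ⊎ i ≡ next i)
  irreflexive = from-yes (all? λ i → ¬? ((i Fin.≟ next i) ⊎-dec (i Fin.≟ next i)))

-- Each colour occurs only twice at `v`, so three distinct other vertices cannot share one. The
-- finitely many quadruples are checked by evaluation.
C₅-colour-degree : ∀ v x y z → Unique (v ∷ x ∷ y ∷ z ∷ []) →
                   ¬ All (λ u → colour C₅ v u ≡ colour C₅ v x) (y ∷ z ∷ [])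
C₅-colour-degree = from-yes (all? λ v → all? λ x → all? λ y → all? λ z →
  allPairs? (λ i j → ¬? (i Fin.≟ j)) (v ∷ x ∷ y ∷ z ∷ []) →-dec
  ¬? (All.all? (λ u → colour C₅ v u ≟ colour C₅ v x) (y ∷ z ∷ [])))

-- The vertex `zero` is the one added last, so its image would have the same colour towards three
-- distinct vertices.
constructible₄-not-in-C₅ : ∀ {K : Graph 4} → Constructible K → ¬ K InducedIn C₅
constructible₄-not-in-C₅ (add b _) (f , f-adj) =
  C₅-colour-degree (to zero) (to (suc zero)) (to (suc (suc zero))) (to (suc (suc (suc zero))))
    (Unique.map⁺ injective (Unique.allFin⁺ 4))
    (same-colour (suc zero) ∷ same-colour (suc (suc zero)) ∷ [])
  where
  open Injection f using (to; injective)

  same-colour : ∀ i → colour C₅ (to zero) (to (suc i)) ≡ colour C₅ (to zero) (to (suc zero))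
  -- Both adjacencies in `C₅` are equivalent to `T b`, to which adjacency with `zero` in
  -- `addVertex b` reduces.
  same-colour i = does-⇔
    (f-adj zero (suc zero) ⇔-∘ ⇔-sym (f-adj zero (suc i)))
    (adj? C₅ (to zero) (to (suc i))) (adj? C₅ (to zero) (to (suc zero)))

¬everyGraphHasThreshold-4-5 : ¬ EveryGraphHasThreshold 4 5
¬everyGraphHasThreshold-4-5 every
  with H , (K , K-constructible , K≅H) , H-induced ← every C₅ =
  constructible₄-not-in-C₅ K-constructible
    (InducedIn-trans {F = K} {H} {C₅} (≅⇒InducedIn {G = K} {H} K≅H) H-induced)

-- Supplies a graph on `m` vertices for every `m`: an induced subgraph of order 3 in it forces 3 ≤
-- `m`.
empty : ∀ n → Graph n
empty n = record { Adj = λ _ _ → ⊥ ; sym = id ; irrefl = λ _ () ; adj? = λ _ _ → no λ () }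

theorem3p13 : (r′₂[ 3 ]≡ 3) × (r′₂[ 4 ]≡ 6)
theorem3p13 =
  (everyGraphHasThreshold-3-3 , λ m every →
    let H , _ , H-induced = every (empty m) in InducedIn⇒≤ {H = H} {empty m} H-induced) ,
  -- A value `m` below 6 is at most 5, so monotonicity carries the property up to 5, where `C₅`
  -- refutes it.
  (everyGraphHasThreshold-4-6 , λ m every → ≮⇒≥ λ m<6 →
    ¬everyGraphHasThreshold-4-5 (EveryGraphHasThreshold-mono (s≤s⁻¹ m<6) every))
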